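{- Let $a,b,c$ be positive integers with $c\ge 2$ and $\gcd(b,c)=1$. Let $\tilde{k}:=\min\{k\in\mathbb{N}: s_k(a)>c-1\}$. Then $e(G_{a,b}(c))=\tilde{k}$.
   Context: $\mathbb{N}$ denotes the set of non-negative integers (including $0$). For positive integers $a,b$ let $\theta_{a,b}:\mathbb{N}\to\mathbb{N}$, $x\mapsto ax+b$. A subsemigroup $G$ of $(\mathbb{N},+)$ containing $0$ is called a $\theta_{a,b}$-semigroup if $\theta_{a,b}(y)\in G$ for every $y\in G\setminus\{0\}$. $G_{a,b}(c)$ denotes the smallest (with respect to inclusion) $\theta_{a,b}$-semigroup containing $c$; under the stated hypotheses it is a numerical semigroup, i.e. a subsemigroup of $(\mathbb{N},+)$ containing $0$ with finite complement in $\mathbb{N}$. For $k\in\mathbb{N}$ set $s_0(a)=0$ and $s_k(a)=\sum_{i=0}^{k-1}a^i$ for $k\ge 1$. Every numerical semigroup $G$ has a unique finite minimal set of generators (a set $S$ generates $G$ if $G$ is the set of all finite linear combinations of elements of $S$ with coefficients in $\mathbb{N}$); its cardinality is the embedding dimension $e(G)$. -}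

module Defs where

open import Data.Empty using (⊥-elim)
open import Data.Fin using (Fin; zero; suc)
open import Data.List using (List; []; _∷_; length; lookup; map; upTo; tabulate; filter; applyUpTo)
open import Data.List.Properties using (map-applyUpTo)
open import Data.List.Membership.Propositional using (_∈_; _∉_)
open import Data.List.Membership.Propositional.Properties using (∈-filter⁺; ∈-filter⁻; ∈-lookup)
open import Data.List.Membership.Propositional.Properties.WithK using (unique∧set⇒bag)
open import Data.List.Membership.DecPropositional using (_∈?_)
open import Data.List.Relation.Binary.BagAndSetEquality using (∼bag⇒↭)
open import Data.List.Relation.Binary.Permutation.Propositional using (_↭_)
open import Data.List.Relation.Binary.Permutation.Propositional.Properties using (↭-length)
open import Data.List.Relation.Binary.Subset.Propositional using () renaming (_⊆_ to _⊆ˡ_)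
open import Data.List.Relation.Unary.Any using (here; there)
open import Data.List.Relation.Unary.Unique.Propositional using (Unique)
open import Data.Nat
open import Data.Nat.ListAction using (sum)
open import Data.Nat.Properties
open import Data.Nat.Tactic.RingSolver using (solve-∀)
open import Data.Product using (∃-syntax; _×_; _,_; proj₁; proj₂)
open import Function using (_∘_; mk⇔)
open import Level using (0ℓ)
open import Relation.Binary.PropositionalEquality
open import Relation.Nullary using (yes; no; ¬?)
open import Relation.Unary using (Pred; _≐_; _⊆_; Decidable)

θ : ℕ → ℕ → ℕ → ℕ
θ a b x = a * x + b

record IsθSemigroup (a b : ℕ) (G : Pred ℕ 0ℓ) : Set where
  field
    0-mem    : G 0
    +-closed : ∀ {x y} → G x → G y → G (x + y)
    θ-closed : ∀ {y} → G y → y ≢ 0 → G (θ a b y)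

-- G is G_{a,b}(c).
record IsSmallestθSemigroup (a b c : ℕ) (G : Pred ℕ 0ℓ) : Set₁ where
  field
    isθSemigroup : IsθSemigroup a b G
    contains     : G c
    smallest     : ∀ (H : Pred ℕ 0ℓ) → IsθSemigroup a b H → H c → G ⊆ H

s : ℕ → ℕ → ℕ
s k a = sum (map (a ^_) (upTo k))

IsMinimum : Pred ℕ 0ℓ → ℕ → Set
IsMinimum P m = P m × (∀ k → P k → m ≤ k)

linComb : (S : List ℕ) → (Fin (length S) → ℕ) → ℕ
linComb S f = sum (tabulate (λ i → f i * lookup S i))

Span : List ℕ → Pred ℕ 0ℓ
Span S x = ∃[ f ] x ≡ linComb S f

Generates : List ℕ → Pred ℕ 0ℓ → Set
Generates S G = Span S ≐ G

-- Finite sets are lists up to _⊆ˡ_ in both directions; minimality is with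
-- respect to inclusion, and `unique` makes `length S` the cardinality.
record IsMinimalGeneratingSet (G : Pred ℕ 0ℓ) (S : List ℕ) : Set where
  field
    unique    : Unique S
    generates : Generates S G
    minimal   : ∀ T → T ⊆ˡ S → Generates T G → S ⊆ˡ T

-- e(G) = n. See embeddingDimension-unique for well-definedness.
HasEmbeddingDimension : Pred ℕ 0ℓ → ℕ → Set
HasEmbeddingDimension G n = ∃[ S ] IsMinimalGeneratingSet G S × length S ≡ n

-- G_{a,b}(c) exists.
data Gen (a b c : ℕ) : Pred ℕ 0ℓ where
  gen-c : Gen a b c c
  gen-0 : Gen a b c 0
  gen-+ : ∀ {x y} → Gen a b c x → Gen a b c y → Gen a b c (x + y)
  gen-θ : ∀ {y} → Gen a b c y → y ≢ 0 → Gen a b c (θ a b y)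

Gen-isSmallest : ∀ a b c → IsSmallestθSemigroup a b c (Gen a b c)
Gen-isSmallest a b c = record
  { isθSemigroup = record { 0-mem = gen-0 ; +-closed = gen-+ ; θ-closed = gen-θ }
  ; contains     = gen-c
  ; smallest     = λ H isθ Hc → go H isθ Hc
  }
  where
  go : ∀ (H : Pred ℕ 0ℓ) → IsθSemigroup a b H → H c → Gen a b c ⊆ H
  go H isθ Hc gen-c       = Hc
  go H isθ Hc gen-0       = IsθSemigroup.0-mem isθ
  go H isθ Hc (gen-+ p q) = IsθSemigroup.+-closed isθ (go H isθ Hc p) (go H isθ Hc q)
  go H isθ Hc (gen-θ p n) = IsθSemigroup.θ-closed isθ (go H isθ Hc p) n

-- The minimum defining k̃ exists.
private
  length≤sum : ∀ (f g : ℕ → ℕ) → (∀ i → 1 ≤ f i) → ∀ k → k ≤ sum (applyUpTo (f ∘ g) k)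
  length≤sum f g f≥1 zero    = z≤n
  length≤sum f g f≥1 (suc k) = +-mono-≤ (f≥1 (g 0)) (length≤sum f (g ∘ suc) f≥1 k)

  k≤s : ∀ a → 1 ≤ a → ∀ k → k ≤ s k a
  k≤s a@(suc _) _ k rewrite map-applyUpTo (λ i → i) (a ^_) k =
    length≤sum (a ^_) (λ i → i) (λ i → m^n>0 a i) k

  search : ∀ {P : Pred ℕ 0ℓ} → Decidable P → ∀ n → P n → ∃[ m ] IsMinimum P m
  search P? zero    p = 0 , p , λ _ _ → z≤n
  search P? (suc n) p with P? 0
  ... | yes p₀ = 0 , p₀ , λ _ _ → z≤n
  ... | no ¬p₀ with search (P? ∘ suc) n p
  ...   | m , pm , least = suc m , pm , λ
            { zero pk → ⊥-elim (¬p₀ pk) ; (suc k) pk → s≤s (least k pk) }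

k̃-exists : ∀ a c → 1 ≤ a → 2 ≤ c → ∃[ k ] IsMinimum (λ k → s k a > c ∸ 1) k
k̃-exists a c@(suc _) 1≤a _ = search (λ k → c ∸ 1 <? s k a) c (k≤s a 1≤a c)

-- The embedding dimension is well defined.
private
  linComb-0 : ∀ S → linComb S (λ _ → 0) ≡ 0
  linComb-0 []      = refl
  linComb-0 (_ ∷ S) = linComb-0 S

  linComb-+ : ∀ S f g → linComb S f + linComb S g ≡ linComb S (λ i → f i + g i)
  linComb-+ []      f g = refl
  linComb-+ (x ∷ S) f g =
    trans (rearrange (f zero) (g zero) x (linComb S (f ∘ suc)) (linComb S (g ∘ suc)))
          (cong ((f zero + g zero) * x +_) (linComb-+ S (f ∘ suc) (g ∘ suc)))
    where
    rearrange : ∀ p q x u v → p * x + u + (q * x + v) ≡ (p + q) * x + (u + v)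
    rearrange = solve-∀

  span-0 : ∀ S → Span S 0
  span-0 S = (λ _ → 0) , sym (linComb-0 S)

  span-+ : ∀ S {x y} → Span S x → Span S y → Span S (x + y)
  span-+ S (f , refl) (g , refl) = (λ i → f i + g i) , linComb-+ S f g

  span-* : ∀ S n {x} → Span S x → Span S (n * x)
  span-* S zero    p = span-0 S
  span-* S (suc n) p = span-+ S p (span-* S n p)

  span-∈ : ∀ {S x} → x ∈ S → Span S x
  span-∈ {y ∷ S} (here refl) = (λ { zero → 1 ; (suc _) → 0 }) ,
    sym (trans (cong₂ _+_ (*-identityˡ y) (linComb-0 S)) (+-identityʳ y))
  span-∈ {y ∷ S} (there x∈S) with span-∈ x∈S
  ... | f , eq = (λ { zero → 0 ; (suc i) → f i }) , eq

  span-elim : ∀ S T f → (∀ i → Span T (f i * lookup S i)) → Span T (linComb S f)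
  span-elim []      T f h = span-0 T
  span-elim (x ∷ S) T f h = span-+ T (h zero) (span-elim S T (f ∘ suc) (h ∘ suc))

  span-mono : ∀ {S T} → (∀ {x} → x ∈ S → Span T x) → Span S ⊆ Span T
  span-mono {S} {T} h (f , refl) =
    span-elim S T f (λ i → span-* T (f i) (h (∈-lookup {xs = S} i)))

  term≤ : ∀ S f i → f i * lookup S i ≤ linComb S f
  term≤ (x ∷ S) f zero    = m≤m+n _ _
  term≤ (x ∷ S) f (suc i) = m≤n⇒m≤o+n (f zero * x) (term≤ S (f ∘ suc) i)

  -- A term with zero coefficient contributes nothing; any other generator
  -- used in a combination is at most its value.
  span-elim-≤ : ∀ {S T n} → (∀ {x} → x ∈ S → x ≤ n → Span T x) →
                ∀ f → linComb S f ≤ n → Span T (linComb S f)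
  span-elim-≤ {S} {T} {n} h f le = span-elim S T f term
    where
    term : ∀ i → Span T (f i * lookup S i)
    term i with f i in eq
    ... | zero  = span-0 T
    ... | suc k = span-* T (suc k) (h (∈-lookup {xs = S} i)
            (≤-trans (≤-trans (m≤m+n (lookup S i) (k * lookup S i))
              (≤-reflexive (cong (_* lookup S i) (sym eq)))) (≤-trans (term≤ S f i) le)))

minimal⊆generating : ∀ {G S T} → IsMinimalGeneratingSet G S → Generates T G → S ⊆ˡ T
minimal⊆generating {G} {S} {T} minS (T⊆G , G⊆T) {u} u∈S with _∈?_ _≟_ u T
... | yes u∈T = u∈T
... | no  u∉T = ⊥-elim (proj₂ (∈-filter⁻ ≢u? {xs = S} (minimal S′ S′⊆S S′-generates u∈S)) refl)
  where
  open IsMinimalGeneratingSet minS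
  ≢u? : Decidable (_≢ u)
  ≢u? x = ¬? (x ≟ u)
  S′ : List ℕ
  S′ = filter ≢u? S
  S′⊆S : S′ ⊆ˡ S
  S′⊆S = proj₁ ∘ ∈-filter⁻ ≢u? {xs = S}
  below : ∀ {t} → Span S t → t < u → Span S′ t
  below (f , refl) t<u = span-elim-≤ {S} {S′}
    (λ x∈S x≤t → span-∈ (∈-filter⁺ ≢u? x∈S (<⇒≢ (≤-<-trans x≤t t<u)))) f ≤-refl
  u-case : Span T u → Span S′ u
  u-case (f , eq) = subst (Span S′) (sym eq) (span-elim-≤ {T} {S′} {u}
    (λ {t} t∈T t≤u → below (proj₂ generates (T⊆G (span-∈ t∈T)))
      (≤∧≢⇒< t≤u (λ { refl → u∉T t∈T }))) f (≤-reflexive (sym eq)))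
  each : ∀ {x} → x ∈ S → Span S′ x
  each {x} x∈S with x ≟ u
  ... | yes refl = u-case (G⊆T (proj₁ generates (span-∈ u∈S)))
  ... | no  x≢u  = span-∈ (∈-filter⁺ ≢u? x∈S x≢u)
  S′-generates : Generates S′ G
  S′-generates = (λ p → proj₁ generates (span-mono {S′} {S} (span-∈ ∘ S′⊆S) p)) ,
                 (λ g → span-mono {S} {S′} each (proj₂ generates g))

minimalGeneratingSet-unique : ∀ {G S T} → IsMinimalGeneratingSet G S →
                              IsMinimalGeneratingSet G T → S ↭ T
minimalGeneratingSet-unique minS minT =
  ∼bag⇒↭ (unique∧set⇒bag (unique minS) (unique minT)
    (mk⇔ (minimal⊆generating minS (generates minT)) (minimal⊆generating minT (generates minS))))
  where open IsMinimalGeneratingSet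

embeddingDimension-unique : ∀ {G m n} → HasEmbeddingDimension G m →
                            HasEmbeddingDimension G n → m ≡ n
embeddingDimension-unique (_ , minS , refl) (_ , minT , refl) =
  ↭-length (minimalGeneratingSet-unique minS minT)

{-# OPTIONS --safe #-}
module Submission where

-- Put d = θ(c) - c = (a - 1) c + b.  Since s_{k+1}(a) = a s_k(a) + 1, the orbit
-- of c under θ is θ^k(c) = c + s_k(a) d (`θ-orbit`), and it generates G_{a,b}(c)
-- because θ(x + y) = θ(x) + a y.  The minimal generating set consists of the
-- θ^k(c) with s_k(a) < c, that is, with k < k̃.
--
-- These generate: they span a set closed under θ as soon as θ^k̃(c) lies in
-- their span.  Writing s_k̃(a) = c + m, minimality of k̃ gives m ≤ 1 + d, and then
-- θ^k̃(c) = m θ(c) + (1 + d - m) c (`redundant`).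
--
-- None can be omitted: a sum of at least two orbit elements has the form
-- (2 + n) c + σ d (`indecomposable-or`).  Were c + s d of this form with s < c,
-- then (s - σ) d would be a positive multiple of c, and hence so would s - σ,
-- since gcd(c , d) = gcd(c , b) = 1; but s - σ ≤ s < c (`indecomposable`).

open import Defs
open import Data.Empty using (⊥-elim)
open import Data.Fin using (Fin; zero; suc)
open import Data.List using (List; []; _∷_; length; applyUpTo)
open import Data.List.Membership.Propositional using (_∈_)
open import Data.List.Membership.Propositional.Properties using (∈-applyUpTo⁺; ∈-applyUpTo⁻)
open import Data.List.Properties using (map-applyUpTo; length-applyUpTo)
open import Data.List.Relation.Unary.Any using (here; there)
import Data.List.Relation.Unary.Unique.Propositional.Properties as Unique
open import Data.Nat using (ℕ; zero; suc; _+_; _*_; _^_; _∸_; _≤_; _<_; _>_; z≤n; s≤s; >-nonZero)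
open import Data.Nat.Coprimality using (Coprime; coprime-divisor; gcd≡1⇒coprime)
open import Data.Nat.Divisibility using (_∣_; divides; ∣⇒≤; ∣m+n∣m⇒∣n; ∣n⇒∣m*n)
open import Data.Nat.GCD using (gcd)
open import Data.Nat.ListAction using (sum)
open import Data.Nat.Properties
open import Data.Nat.Tactic.RingSolver using (solve-∀)
open import Data.Product using (∃-syntax; _×_; _,_; proj₁; proj₂)
open import Data.Sum using (_⊎_; inj₁; inj₂)
open import Function using (_∘_; id)
open import Level using (0ℓ)
open import Relation.Binary.PropositionalEquality
  using (_≡_; _≢_; refl; sym; trans; cong; cong₂; subst; module ≡-Reasoning)
open import Relation.Unary using (Pred; _⊆_)

-- The span of a list as a submonoid of ℕ

span-0 : ∀ S → Span S 0
span-0 S = (λ _ → 0) , sym (all-zero S)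
  where
  all-zero : ∀ S → linComb S (λ _ → 0) ≡ 0
  all-zero []      = refl
  all-zero (_ ∷ S) = all-zero S

span-+ : ∀ S {x y} → Span S x → Span S y → Span S (x + y)
span-+ S (f , refl) (g , refl) = (λ i → f i + g i) , linComb-+ S f g
  where
  rearrange : ∀ p q x u v → p * x + u + (q * x + v) ≡ (p + q) * x + (u + v)
  rearrange = solve-∀

  linComb-+ : ∀ S f g → linComb S f + linComb S g ≡ linComb S (λ i → f i + g i)
  linComb-+ []      f g = refl
  linComb-+ (x ∷ S) f g =
    trans (rearrange (f zero) (g zero) x (linComb S (f ∘ suc)) (linComb S (g ∘ suc)))
          (cong ((f zero + g zero) * x +_) (linComb-+ S (f ∘ suc) (g ∘ suc)))

span-∈ : ∀ {S x} → x ∈ S → Span S x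
span-∈ {x ∷ S} (here refl) = (λ { zero → 1 ; (suc i) → proj₁ (span-0 S) i }) ,
  sym (trans (cong₂ _+_ (*-identityˡ x) (sym (proj₂ (span-0 S)))) (+-identityʳ x))
span-∈ {y ∷ S} (there x∈S) with f , eq ← span-∈ x∈S =
  (λ { zero → 0 ; (suc i) → f i }) , eq

multiples : ∀ {P : Pred ℕ 0ℓ} → P 0 → (∀ {x y} → P x → P y → P (x + y)) →
            ∀ n {x} → P x → P (n * x)
multiples P0 P+ zero    p = P0
multiples {P} P0 P+ (suc n) p = P+ p (multiples {P} P0 P+ n p)

-- Span S is the smallest submonoid of ℕ containing S.
span-elim : ∀ {P : Pred ℕ 0ℓ} → P 0 → (∀ {x y} → P x → P y → P (x + y)) →
            ∀ {S} → (∀ {x} → x ∈ S → P x) → Span S ⊆ P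
span-elim {P} P0 P+ P∈ (f , refl) = go _ f P∈
  where
  go : ∀ S (f : Fin (length S) → ℕ) → (∀ {x} → x ∈ S → P x) → P (linComb S f)
  go []      f P∈ = P0
  go (x ∷ S) f P∈ = P+ (multiples {P} P0 P+ (f zero) (P∈ (here refl))) (go S (f ∘ suc) (P∈ ∘ there))

-- To extend a span by θ it is enough to look at its generators, because
-- θ(x + y) = θ(x) + a y.
span-θ-closed : ∀ a b {S} → (∀ {x} → x ∈ S → Span S (θ a b x)) →
                ∀ {y} → Span S y → y ≢ 0 → Span S (θ a b y)
span-θ-closed a b {S} gen {y} y∈ y≢0
  with proj₂ (span-elim {P} (span-0 S , inj₁ refl) P+ (λ x∈S → span-∈ x∈S , inj₂ (gen x∈S)) y∈)
  where
  P : Pred ℕ 0ℓ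
  P x = Span S x × (x ≡ 0 ⊎ Span S (θ a b x))

  θ-+ : ∀ a b x y → a * x + b + a * y ≡ a * (x + y) + b
  θ-+ = solve-∀

  P+ : ∀ {x y} → P x → P y → P (x + y)
  P+ (x∈ , inj₁ refl) q = q
  P+ {x} {y} (x∈ , inj₂ θx∈) (y∈ , _) = span-+ S x∈ y∈ ,
    inj₂ (subst (Span S) (θ-+ a b x y)
      (span-+ S θx∈ (multiples {Span S} (span-0 S) (span-+ S) a y∈)))
... | inj₁ y≡0 = ⊥-elim (y≢0 y≡0)
... | inj₂ θy∈ = θy∈

-- The repunits s_k(a)

-- Horner's rule s_{k+1}(a) = 1 + a s_k(a).
s-suc : ∀ k a → s (suc k) a ≡ suc (a * s k a)
s-suc k a = cong suc (begin
  _                                   ≡⟨ cong sum (map-applyUpTo suc (a ^_) k) ⟩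
  sum (applyUpTo (λ i → a * a ^ i) k) ≡⟨ scale (a ^_) k ⟩
  a * sum (applyUpTo (a ^_) k)        ≡⟨ cong (λ l → a * sum l) (map-applyUpTo id (a ^_) k) ⟨
  a * s k a                           ∎)
  where
  open ≡-Reasoning
  scale : ∀ (f : ℕ → ℕ) k → sum (applyUpTo (λ i → a * f i) k) ≡ a * sum (applyUpTo f k)
  scale f zero    = sym (*-zeroʳ a)
  scale f (suc k) = trans (cong (a * f 0 +_) (scale (f ∘ suc) k)) (sym (*-distribˡ-+ a (f 0) _))

s-mono-< : ∀ a {i j} → 1 ≤ a → i < j → s i a < s j a
s-mono-< a {i} {suc j} 1≤a i<1+j =
  subst (s i a <_) (sym (s-suc j a)) (s≤s (≤-scaled (m<1+n⇒m<n∨m≡n i<1+j)))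
  where
  instance _ = >-nonZero 1≤a
  ≤-scaled : i < j ⊎ i ≡ j → s i a ≤ a * s j a
  ≤-scaled (inj₁ i<j)  = ≤-trans (<⇒≤ (s-mono-< a 1≤a i<j)) (m≤n*m (s j a) a)
  ≤-scaled (inj₂ refl) = m≤n*m (s j a) a

s≤a*c : ∀ a {c} k → 1 ≤ a → s k a < c → s (suc k) a ≤ a * c
s≤a*c a {c} k 1≤a s<c = begin
  s (suc k) a       ≡⟨ s-suc k a ⟩
  1 + a * s k a     ≤⟨ +-monoˡ-≤ (a * s k a) 1≤a ⟩
  a + a * s k a     ≡⟨ *-suc a (s k a) ⟨
  a * suc (s k a)   ≤⟨ *-monoʳ-≤ a s<c ⟩
  a * c             ∎
  where open ≤-Reasoning

-- The orbit of c under θ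

-- The difference θ(c) - c, for a positive.
step : ℕ → ℕ → ℕ → ℕ
step a b c = (a ∸ 1) * c + b

-- The k-th iterate of θ at c, for a positive, in closed form.
orbit : ℕ → ℕ → ℕ → ℕ → ℕ
orbit a b c k = c + s k a * step a b c

θ-orbit : ∀ {a} b c k → 1 ≤ a → θ a b (orbit a b c k) ≡ orbit a b c (suc k)
θ-orbit {suc a′} b c k _ = trans (affine a′ b c (s k (suc a′)))
  (cong (λ r → c + r * (a′ * c + b)) (sym (s-suc k (suc a′))))
  where
  affine : ∀ a′ b c r → (1 + a′) * (c + r * (a′ * c + b)) + b
                      ≡ c + (1 + (1 + a′) * r) * (a′ * c + b)
  affine = solve-∀

orbit-distinct : ∀ {a b} c {i j} → 1 ≤ a → 1 ≤ b → i < j → orbit a b c i ≢ orbit a b c j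
orbit-distinct {a} {b} c 1≤a 1≤b i<j =
  <⇒≢ (+-monoʳ-< c (*-monoˡ-< (step a b c) (s-mono-< a 1≤a i<j)))
  where instance _ = >-nonZero (≤-trans 1≤b (m≤n+m b ((a ∸ 1) * c)))

orbit≢0 : ∀ {a b c} k → 1 ≤ c → orbit a b c k ≢ 0
orbit≢0 {c = suc _} k _ ()

coprime-step : ∀ a {b c} → Coprime b c → Coprime c (step a b c)
coprime-step a {c = c} cop (q∣c , q∣d) = cop (∣m+n∣m⇒∣n q∣d (∣n⇒∣m*n (a ∸ 1) q∣c) , q∣c)

-- Elements of the form c + σ d

-- A submonoid containing c and c + d contains c + (c + m) d for m ≤ 1 + d, since
-- the latter is m (c + d) + (1 + d - m) c.
redundant : ∀ {P : Pred ℕ 0ℓ} → P 0 → (∀ {x y} → P x → P y → P (x + y)) →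
            ∀ c d m → m ≤ suc d → P c → P (c + d) → P (c + (c + m) * d)
redundant {P} P0 P+ c d m m≤1+d Pc Pc+d with n , m+n≡1+d ← m≤n⇒∃[o]m+o≡n m≤1+d =
  subst P (begin
    m * (c + d) + n * c    ≡⟨ split m n c d ⟩
    (m + n) * c + m * d    ≡⟨ cong (λ e → e * c + m * d) m+n≡1+d ⟩
    suc d * c + m * d      ≡⟨ regroup m c d ⟩
    c + (c + m) * d        ∎)
    (P+ (multiples {P} P0 P+ m Pc+d) (multiples {P} P0 P+ n Pc))
  where
  open ≡-Reasoning
  split : ∀ m n c d → m * (c + d) + n * c ≡ (m + n) * c + m * d
  split = solve-∀
  regroup : ∀ m c d → (1 + d) * c + m * d ≡ c + (c + m) * d
  regroup = solve-∀

-- The right-hand side is the form of a sum of 2 + n elements c + σᵢ d, so c + r d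
-- with r < c is not a sum of two or more elements of this kind.
indecomposable : ∀ {c d r} → Coprime c d → r < c → ∀ n σ → c + r * d ≢ (2 + n) * c + σ * d
indecomposable {c} {d} {r} cop r<c n σ eq with <-≤-connex σ r
... | inj₂ r≤σ = <⇒≢ (begin-strict
    c + r * d               ≤⟨ +-monoʳ-≤ c (*-monoˡ-≤ d r≤σ) ⟩
    c + σ * d               <⟨ +-monoˡ-< (σ * d) (m<m+n c (≤-trans (≤-<-trans z≤n r<c) (m≤m+n c (n * c)))) ⟩
    (2 + n) * c + σ * d     ∎) eq
  where open ≤-Reasoning
... | inj₁ σ<r with o , refl ← m≤n⇒∃[o]m+o≡n σ<r =
  <⇒≱ r<c (≤-trans (∣⇒≤ c∣1+o) (s≤s (m≤n+m o σ)))
  where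
  regroupˡ : ∀ c d σ o → c + (1 + σ + o) * d ≡ (c + σ * d) + d * (1 + o)
  regroupˡ = solve-∀
  regroupʳ : ∀ c d σ n → (2 + n) * c + σ * d ≡ (c + σ * d) + (1 + n) * c
  regroupʳ = solve-∀
  c∣1+o : c ∣ suc o
  c∣1+o = coprime-divisor cop (divides (suc n) (+-cancelˡ-≡ (c + σ * d) _ _
    (trans (sym (regroupˡ c d σ o)) (trans eq (regroupʳ c d σ n)))))

-- A combination of elements c + σ d is empty, a single generator, or has at
-- least two terms.
indecomposable-or : ∀ c d {T} → (∀ {x} → x ∈ T → ∃[ σ ] x ≡ c + σ * d) →
  ∀ {x} → Span T x → x ≡ 0 ⊎ x ∈ T ⊎ ∃[ n ] ∃[ σ ] x ≡ (2 + n) * c + σ * d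
indecomposable-or c d {T} form = span-elim {Q} (inj₁ refl) Q+ (inj₂ ∘ inj₁)
  where
  -- The form taken by a combination of at least k elements c + σ d.
  AtLeast : ℕ → Pred ℕ 0ℓ
  AtLeast k x = ∃[ n ] ∃[ σ ] x ≡ (k + n) * c + σ * d

  Q : Pred ℕ 0ℓ
  Q x = x ≡ 0 ⊎ x ∈ T ⊎ AtLeast 2 x

  nonempty : ∀ {x} → x ∈ T ⊎ AtLeast 2 x → AtLeast 1 x
  nonempty (inj₁ x∈T) with σ , refl ← form x∈T = 0 , σ , cong (_+ σ * d) (sym (*-identityˡ c))
  nonempty (inj₂ (n , σ , eq)) = suc n , σ , eq

  add : ∀ m n σ τ c d → (1 + m) * c + σ * d + ((1 + n) * c + τ * d)
                      ≡ (2 + (m + n)) * c + (σ + τ) * d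
  add = solve-∀

  Q+ : ∀ {x y} → Q x → Q y → Q (x + y)
  Q+ (inj₁ refl) q = q
  Q+ {x} p@(inj₂ _) (inj₁ refl) = subst Q (sym (+-identityʳ x)) p
  Q+ (inj₂ p) (inj₂ q) with m , σ , refl ← nonempty p | n , τ , refl ← nonempty q =
    inj₂ (inj₂ (m + n , σ + τ , add m n σ τ c d))

-- The last two hypotheses say that k̃ is the least k with s_k(a) ≥ c; together
-- with 2 ≤ c they imply 2 ≤ k̃.
orbit-minimalGeneratingSet :
  ∀ {a b c G} k̃ → 1 ≤ a → 1 ≤ b → 2 ≤ c → Coprime b c →
  IsSmallestθSemigroup a b c G → 2 ≤ k̃ → (∀ {i} → i < k̃ → s i a < c) → c ≤ s k̃ a →
  IsMinimalGeneratingSet G (applyUpTo (orbit a b c) k̃)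
orbit-minimalGeneratingSet {a} {b} {c} {G} k̃ 1≤a 1≤b 2≤c cop smallestG 2≤k̃ s<c c≤s = record
  { unique    = Unique.applyUpTo⁺₁ t k̃ (λ i<j _ → orbit-distinct c 1≤a 1≤b i<j)
  ; generates = S⊆G , G⊆S
  ; minimal   = minimal
  }
  where
  open IsSmallestθSemigroup smallestG
  open IsθSemigroup isθSemigroup

  1≤c : 1 ≤ c
  1≤c = <⇒≤ 2≤c

  d : ℕ
  d = step a b c

  t : ℕ → ℕ
  t = orbit a b c

  S : List ℕ
  S = applyUpTo t k̃

  ∈S : ∀ {x} → x ∈ S → ∃[ i ] i < k̃ × x ≡ t i
  ∈S = ∈-applyUpTo⁻ t

  t∈G : ∀ i → G (t i)
  t∈G zero    = subst G (sym (+-identityʳ c)) contains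
  t∈G (suc i) = subst G (θ-orbit b c i 1≤a) (θ-closed (t∈G i) (orbit≢0 {a} {b} i 1≤c))

  S⊆G : Span S ⊆ G
  S⊆G = span-elim {G} 0-mem +-closed λ x∈S →
    let i , _ , x≡ti = ∈S x∈S in subst G (sym x≡ti) (t∈G i)

  t∈S : ∀ {i} → i < k̃ → Span S (t i)
  t∈S i<k̃ = span-∈ (∈-applyUpTo⁺ t i<k̃)

  c∈S : Span S c
  c∈S = subst (Span S) (+-identityʳ c) (t∈S (<⇒≤ 2≤k̃))

  c+d∈S : Span S (c + d)
  c+d∈S = subst (λ e → Span S (c + e)) (*-identityˡ d) (t∈S 2≤k̃)

  s≤c+d : ∀ {k} → suc k ≡ k̃ → s k̃ a ≤ c + d
  s≤c+d {k} refl = begin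
    s (suc k) a             ≤⟨ s≤a*c a k 1≤a (s<c ≤-refl) ⟩
    a * c                   ≡⟨ cong (_* c) (m+[n∸m]≡n 1≤a) ⟨
    c + (a ∸ 1) * c         ≤⟨ +-monoʳ-≤ c (m≤m+n ((a ∸ 1) * c) b) ⟩
    c + d                   ∎
    where open ≤-Reasoning

  last∈S : ∀ {k} → suc k ≡ k̃ → Span S (t k̃)
  last∈S 1+k≡k̃ with m , c+m≡s ← m≤n⇒∃[o]m+o≡n c≤s =
    subst (λ r → Span S (c + r * d)) c+m≡s
      (redundant {Span S} (span-0 S) (span-+ S) c d m (m≤n⇒m≤1+n m≤d) c∈S c+d∈S)
    where
    m≤d : m ≤ d
    m≤d = +-cancelˡ-≤ c m d (subst (_≤ c + d) (sym c+m≡s) (s≤c+d 1+k≡k̃))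

  next∈S : ∀ {i} → i < k̃ → Span S (t (suc i))
  next∈S i<k̃ with m≤n⇒m<n∨m≡n i<k̃
  ... | inj₁ 1+i<k̃ = t∈S 1+i<k̃
  ... | inj₂ 1+i≡k̃ = subst (Span S ∘ t) (sym 1+i≡k̃) (last∈S 1+i≡k̃)

  θ-generator : ∀ {x} → x ∈ S → Span S (θ a b x)
  θ-generator x∈S with i , i<k̃ , refl ← ∈S x∈S =
    subst (Span S) (sym (θ-orbit b c i 1≤a)) (next∈S i<k̃)

  G⊆S : G ⊆ Span S
  G⊆S = smallest (Span S) record
    { 0-mem    = span-0 S
    ; +-closed = span-+ S
    ; θ-closed = span-θ-closed a b θ-generator
    } c∈S

  minimal : ∀ T → (∀ {x} → x ∈ T → x ∈ S) → Generates T G → ∀ {u} → u ∈ S → u ∈ T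
  minimal T T⊆S (_ , G⊆T) u∈S with j , j<k̃ , refl ← ∈S u∈S
    with indecomposable-or c d (λ x∈T → let i , _ , x≡ti = ∈S (T⊆S x∈T) in s i a , x≡ti) (G⊆T (t∈G j))
  ... | inj₁ tj≡0                = ⊥-elim (orbit≢0 {a} {b} j 1≤c tj≡0)
  ... | inj₂ (inj₁ tj∈T)         = tj∈T
  ... | inj₂ (inj₂ (n , σ , eq)) = ⊥-elim (indecomposable (coprime-step a cop) (s<c j<k̃) n σ eq)

corollary3p3 : ∀ (a b c : ℕ) → 1 ≤ a → 1 ≤ b → 2 ≤ c → gcd b c ≡ 1 →
    ∀ (G : Pred ℕ 0ℓ) → IsSmallestθSemigroup a b c G →
    ∀ (k̃ : ℕ) → IsMinimum (λ k → s k a > c ∸ 1) k̃ →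
    HasEmbeddingDimension G k̃
corollary3p3 a b c@(suc _) 1≤a 1≤b 2≤c gcd≡1 G smallestG k̃ (c≤s , least) =
  applyUpTo (orbit a b c) k̃ ,
  orbit-minimalGeneratingSet k̃ 1≤a 1≤b 2≤c (gcd≡1⇒coprime gcd≡1) smallestG (2≤k̃ k̃ c≤s)
    (λ {i} i<k̃ → s≤s (≮⇒≥ (λ c≤sᵢ → <⇒≱ i<k̃ (least i c≤sᵢ)))) c≤s ,
  length-applyUpTo (orbit a b c) k̃
  where
  -- s_0(a) = 0 and s_1(a) = 1 are both less than c.
  2≤k̃ : ∀ k → c ≤ s k a → 2 ≤ k
  2≤k̃ 0             c≤0 = ⊥-elim (<⇒≱ 2≤c (≤-trans c≤0 z≤n))
  2≤k̃ 1             c≤1 = ⊥-elim (<⇒≱ 2≤c c≤1)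
  2≤k̃ (suc (suc _)) _   = s≤s (s≤s z≤n)
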